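{- Let $G$ be a finite, simple, connected graph of order $n\ge 3$. Then $res_{wt}(G)=n$ if and only if $G$ contains a twin (i.e. some vertex of $G$ is a twin).
   Context: $d(x,y)$ is the shortest-path distance and $N(x)$ the set of neighbors of $x$. A set $W\subseteq V(G)$ is a resolving set if for every two distinct vertices $y,z$ there is $x\in W$ with $d(y,x)\ne d(z,x)$. A set $W$ is a weak total resolving set (WTR-set) if $W$ is resolving and, for every $w\in W$ and every $x\in V(G)\setminus W$, there is $w'\in W\setminus\{w\}$ with $d(x,w')\ne d(w,w')$. The weak total resolving number $res_{wt}(G)$ is the minimum positive integer $r$ such that every set of $r$ vertices of $G$ is a WTR-set for $G$. Two distinct vertices $u,v$ are twins if $N(u)\setminus\{v\}=N(v)\setminus\{u\}$; a vertex $u$ is a twin if there exists $v\ne u$ such that $u,v$ are twins. -}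

module Defs where

open import Data.Fin using (Fin; _≟_)
open import Data.Fin.Properties using (any?; all?)
open import Data.Fin.Subset using (Subset; _∈_; _∉_; _-_; ∣_∣)
open import Data.Fin.Subset.Properties using (_∈?_; anySubset?; ∣p∣≤n)
open import Data.Nat using (ℕ; zero; suc; _≤_; z≤n; s≤s; _≤?_)
import Data.Nat.Properties as ℕ
open import Data.Product using (∃; _×_; _,_; proj₁)
open import Data.Vec using (Vec; []; _∷_; head; last)
open import Data.Vec.Relation.Unary.Linked using (Linked; linked?)
open import Data.Vec.Relation.Unary.AllPairs using (allPairs?)
open import Data.Vec.Relation.Unary.Unique.Propositional using (Unique)
open import Function using (_∘_)
open import Level using (0ℓ)
open import Relation.Binary using (Rel; Symmetric)
import Relation.Binary as Binary
open import Relation.Binary.PropositionalEquality as ≡ using (_≡_; _≢_)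
open import Relation.Nullary using (¬_; Dec; yes; no; contradiction)
open import Relation.Nullary.Decidable
  using (map′; decidable-stable; ¬?; _×-dec_; _→-dec_)
open import Relation.Unary using (Pred; Decidable; _∖_; ｛_｝; _≐_)

Minimum : Pred ℕ 0ℓ → Set
Minimum P = ∃ λ k → P k × (∀ j → P j → k ≤ j)

minimum : {P : Pred ℕ 0ℓ} → Decidable P → ∃ P → Minimum P
minimum P? (m , pm) = search P? m pm
  where
  search : {P : Pred ℕ 0ℓ} → Decidable P → ∀ m → P m → Minimum P
  search P? m pm with P? 0
  search P? m       pm | yes p0 = 0 , p0 , λ _ _ → z≤n
  search P? zero    p0 | no ¬p0 = contradiction p0 ¬p0
  search P? (suc m) pm | no ¬p0 with search (P? ∘ suc) m pm
  ... | k , pk , least = suc k , pk , λ where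
    zero    p0 → contradiction p0 ¬p0
    (suc j) pj → s≤s (least j pj)

anyVec? : ∀ {n} k {P : Pred (Vec (Fin n) k) 0ℓ} → Decidable P → Dec (∃ P)
anyVec? zero    P? = map′ (λ p → [] , p) (λ { ([] , p) → p }) (P? [])
anyVec? (suc k) P? =
  map′ (λ { (x , xs , p) → x ∷ xs , p }) (λ { (x ∷ xs , p) → x , xs , p })
       (any? λ x → anyVec? k (P? ∘ (x ∷_)))

allSubset? : ∀ {n} {P : Pred (Subset n) 0ℓ} → Decidable P → Dec (∀ W → P W)
allSubset? P? =
  map′ (λ ¬∃ W → decidable-stable (P? W) (λ ¬p → ¬∃ (W , ¬p)))
       (λ { ∀P (W , ¬p) → ¬p (∀P W) })
       (¬? (anySubset? (¬? ∘ P?)))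

record Graph (n : ℕ) : Set₁ where
  field
    Adj    : Rel (Fin n) 0ℓ
    adj?   : Binary.Decidable Adj
    sym    : Symmetric Adj
    irrefl : ∀ {x} → ¬ Adj x x

module _ {n : ℕ} (G : Graph n) where
  open Graph G

  N : Fin n → Pred (Fin n) 0ℓ
  N x = Adj x

  Twins : Rel (Fin n) 0ℓ
  Twins u v = u ≢ v × N u ∖ ｛ v ｝ ≐ N v ∖ ｛ u ｝

  IsTwin : Pred (Fin n) 0ℓ
  IsTwin u = ∃ λ v → Twins u v

  -- The length k counts edges, so a path of length k lists suc k vertices.
  IsPath : Fin n → Fin n → (k : ℕ) → Pred (Vec (Fin n) (suc k)) 0ℓ
  IsPath x y k vs = head vs ≡ x × last vs ≡ y × Linked Adj vs × Unique vs

  HasPath : Fin n → Fin n → Pred ℕ 0ℓ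
  HasPath x y k = ∃ (IsPath x y k)

  hasPath? : ∀ x y → Decidable (HasPath x y)
  hasPath? x y k = anyVec? (suc k) λ vs →
    (head vs ≟ x) ×-dec (last vs ≟ y) ×-dec
    linked? adj? vs ×-dec allPairs? (λ u v → ¬? (u ≟ v)) vs

  Connected : Set
  Connected = ∀ x y → ∃ (HasPath x y)

module _ {n : ℕ} (G : Graph n) (conn : Connected G) where

  d : Fin n → Fin n → ℕ
  d x y = proj₁ (minimum (hasPath? G x y) (conn x y))

  IsResolving : Pred (Subset n) 0ℓ
  IsResolving W = ∀ y z → y ≢ z → ∃ λ x → x ∈ W × d y x ≢ d z x

  IsWTR : Pred (Subset n) 0ℓ
  IsWTR W = IsResolving W ×
    (∀ w x → w ∈ W → x ∉ W → ∃ λ w′ → w′ ∈ W - w × d x w′ ≢ d w w′)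

  AllWTR : Pred ℕ 0ℓ
  AllWTR r = 1 ≤ r × (∀ W → ∣ W ∣ ≡ r → IsWTR W)

  isWTR? : Decidable IsWTR
  isWTR? W =
    all? (λ y → all? λ z → ¬? (y ≟ z) →-dec
      any? λ x → (x ∈? W) ×-dec ¬? (d y x ℕ.≟ d z x))
    ×-dec
    all? (λ w → all? λ x → (w ∈? W) →-dec (¬? (x ∈? W) →-dec
      any? λ w′ → (w′ ∈? (W - w)) ×-dec ¬? (d x w′ ℕ.≟ d w w′)))

  allWTR? : Decidable AllWTR
  allWTR? r = (1 ≤? r) ×-dec allSubset? λ W → (∣ W ∣ ℕ.≟ r) →-dec isWTR? W

  -- suc n satisfies AllWTR vacuously. It only bounds the search: for n ≥ 1 the
  -- whole vertex set is a WTR-set, so the minimum is at most n.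
  allWTR-inhabited : ∃ AllWTR
  allWTR-inhabited = suc n , s≤s z≤n , λ W ∣W∣≡1+n →
    contradiction (∣p∣≤n W) (ℕ.<⇒≱ (ℕ.≤-reflexive (≡.sym ∣W∣≡1+n)))

  res-wt : ℕ
  res-wt = proj₁ (minimum allWTR? allWTR-inhabited)

{-# OPTIONS --safe #-}

-- Two distinct vertices are twins exactly when no third vertex separates them,
-- that is, lies at different distances from them. If u and v are twins, a set
-- of any size r with 1 ≤ r < n can be chosen to contain u but not v; it is not a
-- WTR-set, since nothing in it besides u tells u from v. If there are no twins,
-- the complement of a single vertex x is a WTR-set: each pair w, x has a
-- separating third vertex, which lies in the complement.

module Submission where

open import Defs
open import Data.Fin using (Fin; _≟_)
open import Data.Fin.Properties using (any?)
open import Data.Fin.Subset using (Subset; _∈_; _∉_; _⊆_; _-_; ∁; ⁅_⁆; ∣_∣; inside; outside)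
open import Data.Fin.Subset.Properties
  using (_∈?_; drop-∷-⊆; out⊆; s⊆s; ∈⊤; ∣p∣≡n⇒p≡⊤; x∈⁅x⁆; x∈⁅y⁆⇒x≡y; ∣⁅x⁆∣≡1;
         x∈∁p⇒x∉p; x∉p⇒x∈∁p; ∣∁p∣≡n∸∣p∣; p─q⊆p; p─q─q≡p─q; ⊂-irref;
         x∈p∧x≢y⇒x∈p-y; x∈p⇒p-x⊂p; x∈p⇒∣p-x∣<∣p∣)
open import Data.Nat using (ℕ; suc; _∸_; _≤_; _<_; _≥_; z≤n; s≤s; s≤s⁻¹)
import Data.Nat.Properties as ℕ
open import Data.Product using (∃; _×_; _,_; proj₁; proj₂)
open import Data.Sum as Sum using (_⊎_; inj₁; inj₂; [_,_]′; fromInj₁; swap)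
open import Data.Vec using (Vec; []; _∷_; last; here)
open import Data.Vec.Relation.Unary.All as All using ([]; _∷_)
open import Data.Vec.Relation.Unary.AllPairs using ([]; _∷_)
open import Data.Vec.Relation.Unary.Any as Any using (Any)
open import Data.Vec.Relation.Unary.Linked using (Linked; [-]; _∷_)
open import Data.Vec.Relation.Unary.Unique.Propositional using (Unique)
open import Function.Bundles using (_⇔_; mk⇔)
open import Relation.Binary.PropositionalEquality
  using (_≡_; _≢_; refl; sym; trans; cong; subst; ≢-sym)
open import Relation.Nullary using (¬_; yes; no; contradiction)
open import Relation.Nullary.Decidable using (decidable-stable; toSum; ¬?; _×-dec_)
open import Relation.Unary using (Decidable)

-- Removing a member makes a set strictly smaller, yet removing `x` from `p - x` changes nothing.
x∉p-x : ∀ {n} {p : Subset n} {x} → x ∉ p - x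
x∉p-x {p = p} {x} x∈p-x = ⊂-irref (p─q─q≡p─q p ⁅ x ⁆) (x∈p⇒p-x⊂p x∈p-x)

between : ∀ {n r} {p q : Subset n} → p ⊆ q → ∣ p ∣ ≤ r → r ≤ ∣ q ∣ →
  ∃ λ W → p ⊆ W × W ⊆ q × ∣ W ∣ ≡ r
between {p = []} {[]} _ _ z≤n = [] , (λ ()) , (λ ()) , refl
between {p = inside ∷ p} {outside ∷ q} p⊆q _ _ with () ← p⊆q here
between {p = inside ∷ p} {inside ∷ q} p⊆q (s≤s p≤r) (s≤s r≤q) =
  let W , p⊆W , W⊆q , eq = between (drop-∷-⊆ p⊆q) p≤r r≤q
  in inside ∷ W , s⊆s p⊆W , s⊆s W⊆q , cong suc eq
between {p = outside ∷ p} {outside ∷ q} p⊆q p≤r r≤q =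
  let W , p⊆W , W⊆q , eq = between (drop-∷-⊆ p⊆q) p≤r r≤q
  in outside ∷ W , s⊆s p⊆W , s⊆s W⊆q , eq
-- The only real choice is at a position in `q` but not in `p`: it is added as long as `p` has fewer
-- than `r` elements; otherwise `p` itself serves as `W`.
between {p = outside ∷ p} {inside ∷ q} p⊆q p≤r r≤1+q with ℕ.m≤n⇒m<n∨m≡n p≤r
... | inj₂ p≡r = outside ∷ p , (λ x∈ → x∈) , p⊆q , p≡r
... | inj₁ (s≤s p≤r-1) =
  let W , p⊆W , W⊆q , eq = between (drop-∷-⊆ p⊆q) p≤r-1 (s≤s⁻¹ r≤1+q)
  in inside ∷ W , out⊆ p⊆W , s⊆s W⊆q , cong suc eq

separating-subset : ∀ {n r} {u v : Fin n} → u ≢ v → 1 ≤ r → r < n →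
  ∃ λ W → u ∈ W × v ∉ W × ∣ W ∣ ≡ r
separating-subset {n} {r} {u} {v} u≢v 1≤r r<n =
  let W , ⁅u⁆⊆W , W⊆∁⁅v⁆ , eq = between ⁅u⁆⊆∁⁅v⁆ ∣⁅u⁆∣≤r r≤∣∁⁅v⁆∣
  in W , ⁅u⁆⊆W (x∈⁅x⁆ u) , (λ v∈W → x∈∁p⇒x∉p (W⊆∁⁅v⁆ v∈W) (x∈⁅x⁆ v)) , eq
  where
  ⁅u⁆⊆∁⁅v⁆ : ⁅ u ⁆ ⊆ ∁ ⁅ v ⁆
  ⁅u⁆⊆∁⁅v⁆ x∈⁅u⁆ = x∉p⇒x∈∁p λ x∈⁅v⁆ →
    u≢v (trans (sym (x∈⁅y⁆⇒x≡y u x∈⁅u⁆)) (x∈⁅y⁆⇒x≡y v x∈⁅v⁆))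
  ∣⁅u⁆∣≤r : ∣ ⁅ u ⁆ ∣ ≤ r
  ∣⁅u⁆∣≤r = subst (_≤ r) (sym (∣⁅x⁆∣≡1 u)) 1≤r
  r≤∣∁⁅v⁆∣ : r ≤ ∣ ∁ ⁅ v ⁆ ∣
  r≤∣∁⁅v⁆∣ = subst (r ≤_)
    (sym (trans (∣∁p∣≡n∸∣p∣ ⁅ v ⁆) (cong (n ∸_) (∣⁅x⁆∣≡1 v)))) (ℕ.∸-monoˡ-≤ 1 r<n)

∣∁p∣≤1⇒omitted-unique : ∀ {n} {p : Subset n} → ∣ ∁ p ∣ ≤ 1 →
  ∀ {x y} → x ∉ p → y ∉ p → x ≡ y
∣∁p∣≤1⇒omitted-unique {p = p} ∣∁p∣≤1 {x} {y} x∉p y∉p = decidable-stable (x ≟ y) λ x≢y →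
  let x∈∁p-y = x∈p∧x≢y⇒x∈p-y (x∉p⇒x∈∁p x∉p) x≢y
      -- Removing `y` and then `x` from `∁ p` lowers the size strictly each time.
      2≤∣∁p∣ = ℕ.≤-<-trans (ℕ.≤-<-trans z≤n (x∈p⇒∣p-x∣<∣p∣ x∈∁p-y))
                           (x∈p⇒∣p-x∣<∣p∣ (x∉p⇒x∈∁p y∉p))
  in ℕ.<⇒≱ 2≤∣∁p∣ ∣∁p∣≤1

module _ {n : ℕ} (G : Graph n) where
  open Graph G hiding (sym)

  path-suffix : ∀ {k u} {vs : Vec (Fin n) (suc k)} → Linked Adj vs → Unique vs →
    Any (u ≡_) vs → ∃ λ j → j ≤ k × HasPath G u (last vs) j
  path-suffix linked unique (Any.here refl) =
    _ , ℕ.≤-refl , _ , refl , refl , linked , unique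
  path-suffix {suc k} (_ ∷ linked) (_ ∷ unique) (Any.there u∈vs) =
    let j , j≤k , path = path-suffix linked unique u∈vs
    in j , ℕ.m≤n⇒m≤1+n j≤k , path

  -- Paths may not repeat vertices. If `u` already occurs, the path is cut at that occurrence, which
  -- is why the length is only bounded by `suc k`.
  prepend : ∀ {u x y k} → Adj u x → HasPath G x y k → ∃ λ j → j ≤ suc k × HasPath G u y j
  prepend {u} ux (x ∷ xs , refl , refl , linked , unique)
    with All.decide (λ v → swap (toSum (u ≟ v))) (x ∷ xs)
  ... | inj₁ u∉xs = _ , ℕ.≤-refl , u ∷ x ∷ xs , refl , refl , ux ∷ linked , u∉xs ∷ unique
  ... | inj₂ u∈xs =
    let j , j≤k , path = path-suffix linked unique u∈xs
    in j , ℕ.m≤n⇒m≤1+n j≤k , path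

  -- The second vertex x of a path from v is either u itself, or a neighbour of
  -- u because u and v are twins.
  twin-path : ∀ {u v w k} → Twins G u v → w ≢ v → HasPath G v w k →
    ∃ λ j → j ≤ k × HasPath G u w j
  twin-path twins w≢v (v ∷ [] , refl , refl , _) = contradiction refl w≢v
  twin-path {u} (_ , _ , Nv⊆Nu) w≢v (v ∷ x ∷ xs , refl , last≡w , vx ∷ linked , _ ∷ unique)
    with u ≟ x
  ... | yes u≡x = _ , ℕ.n≤1+n _ , x ∷ xs , sym u≡x , last≡w , linked , unique
  ... | no u≢x = prepend (proj₁ (Nv⊆Nu (vx , u≢x))) (x ∷ xs , refl , last≡w , linked , unique)

  twins-sym : ∀ {u v} → Twins G u v → Twins G v u
  twins-sym (u≢v , Nu⊆Nv , Nv⊆Nu) = ≢-sym u≢v , Nv⊆Nu , Nu⊆Nv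

  module _ (conn : Connected G) where

    private
      dist : Fin n → Fin n → ℕ
      dist = d G conn

    shortest-path : ∀ x y → HasPath G x y (dist x y)
    shortest-path x y = proj₁ (proj₂ (minimum (hasPath? G x y) (conn x y)))

    d-least : ∀ {x y k} → HasPath G x y k → dist x y ≤ k
    d-least {x} {y} = proj₂ (proj₂ (minimum (hasPath? G x y) (conn x y))) _

    d-refl : ∀ x → dist x x ≡ 0
    d-refl x = ℕ.n≤0⇒n≡0 (d-least (x ∷ [] , refl , refl , [-] , [] ∷ []))

    d≡0⇒≡ : ∀ {x y} → dist x y ≡ 0 → x ≡ y
    d≡0⇒≡ {x} {y} d≡0
      with x ∷ [] , refl , refl , _ ← subst (HasPath G x y) d≡0 (shortest-path x y) = refl

    -- Distance zero occurs only from a vertex to itself, so every vertex resolves each pair that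
    -- contains it.
    d-self≢ : ∀ {y z} → y ≢ z → dist y y ≢ dist z y
    d-self≢ y≢z eq = y≢z (sym (d≡0⇒≡ (trans (sym eq) (d-refl _))))

    adj⇒d≤1 : ∀ {x y} → Adj x y → dist x y ≤ 1
    adj⇒d≤1 {x} {y} xy = d-least
      (x ∷ y ∷ [] , refl , refl , xy ∷ [-] , ((λ { refl → irrefl xy }) ∷ []) ∷ [] ∷ [])

    d≤1⇒adj : ∀ {x y} → x ≢ y → dist x y ≤ 1 → Adj x y
    d≤1⇒adj {x} {y} x≢y d≤1 with dist x y | shortest-path x y
    ... | 0 | _ ∷ [] , refl , refl , _ = contradiction refl x≢y
    ... | 1 | _ ∷ _ ∷ [] , refl , refl , xy ∷ _ , _ = xy
    d≤1⇒adj x≢y (s≤s ()) | suc (suc _) | _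

    -- `u` and `v` are excluded because each trivially resolves the pair. The WTR condition at
    -- `w ∈ W`, `x ∉ W` asks for just such a third vertex, taken from `W`.
    Separates : Fin n → Fin n → Fin n → Set
    Separates u v w = w ≢ u × w ≢ v × dist u w ≢ dist v w

    separates? : ∀ u v → Decidable (Separates u v)
    separates? u v w = ¬? (w ≟ u) ×-dec ¬? (w ≟ v) ×-dec ¬? (dist u w ℕ.≟ dist v w)

    twins-d≤ : ∀ {u v w} → Twins G u v → w ≢ v → dist u w ≤ dist v w
    twins-d≤ twins w≢v =
      let _ , j≤d , path = twin-path twins w≢v (shortest-path _ _)
      in ℕ.≤-trans (d-least path) j≤d

    twins⇒unseparated : ∀ {u v} → Twins G u v → ¬ ∃ (Separates u v)
    twins⇒unseparated twins (w , w≢u , w≢v , ≢d) =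
      ≢d (ℕ.≤-antisym (twins-d≤ twins w≢v) (twins-d≤ (twins-sym twins) w≢u))

    -- For distinct vertices, adjacency means distance at most 1, so equal distances to every third
    -- vertex force equal neighbourhoods outside the pair.
    unseparated⇒twins : ∀ {u v} → u ≢ v → ¬ ∃ (Separates u v) → Twins G u v
    unseparated⇒twins {u} {v} u≢v ¬sep =
        u≢v
      , (λ (ux , v≢x) → let u≢x = adj⇒≢ ux in
          d≤1⇒adj v≢x (subst (_≤ 1) (d≡ u≢x v≢x) (adj⇒d≤1 ux)) , u≢x)
      , (λ (vx , u≢x) → let v≢x = adj⇒≢ vx in
          d≤1⇒adj u≢x (subst (_≤ 1) (sym (d≡ u≢x v≢x)) (adj⇒d≤1 vx)) , v≢x)
      where
      adj⇒≢ : ∀ {x y} → Adj x y → x ≢ y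
      adj⇒≢ xy refl = irrefl xy
      d≡ : ∀ {x} → u ≢ x → v ≢ x → dist u x ≡ dist v x
      d≡ {x} u≢x v≢x = decidable-stable (dist u x ℕ.≟ dist v x) λ ≢d →
        ¬sep (x , ≢-sym u≢x , ≢-sym v≢x , ≢d)

    -- All searches range over finitely many vertices, so the dichotomy is decidable and the second
    -- case yields actual separators.
    twin-or-separated : ∃ (IsTwin G) ⊎ (∀ u v → u ≢ v → ∃ (Separates u v))
    twin-or-separated = Sum.map
      (λ (u , v , u≢v , ¬sep) → u , v , unseparated⇒twins u≢v ¬sep)
      (λ ¬unseparated u v u≢v → decidable-stable (any? (separates? u v)) λ ¬sep →
        ¬unseparated (u , v , u≢v , ¬sep))
      (toSum (any? λ u → any? λ v → ¬? (u ≟ v) ×-dec ¬? (any? (separates? u v))))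

    -- At least one of `y` and `z` lies in `W`, and that vertex resolves the pair.
    omitted-unique⇒resolving : ∀ {W} → (∀ {x y} → x ∉ W → y ∉ W → x ≡ y) →
      IsResolving G conn W
    omitted-unique⇒resolving {W} unique y z y≢z =
      [ (λ y∈W → y , y∈W , d-self≢ {y} {z} y≢z)
      , (λ y∉W → z , z∈W y∉W , ≢-sym (d-self≢ {z} {y} (≢-sym y≢z)))
      ]′ (toSum (y ∈? W))
      where
      z∈W : y ∉ W → z ∈ W
      z∈W y∉W = decidable-stable (z ∈? W) λ z∉W → y≢z (unique y∉W z∉W)

    allWTR-order : 1 ≤ n → AllWTR G conn n
    allWTR-order 1≤n = 1≤n , λ W ∣W∣≡n →
      let all∈W = λ x → subst (x ∈_) (sym (∣p∣≡n⇒p≡⊤ ∣W∣≡n)) ∈⊤ in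
        omitted-unique⇒resolving (λ {x} x∉W _ → contradiction (all∈W x) x∉W)
      , λ _ x _ x∉W → contradiction (all∈W x) x∉W

    twins⇒¬allWTR : ∀ {u v r} → Twins G u v → r < n → ¬ AllWTR G conn r
    twins⇒¬allWTR {u} {v} twins r<n (1≤r , wtr)
      with W , u∈W , v∉W , ∣W∣≡r ← separating-subset (proj₁ twins) 1≤r r<n
      -- The witness differs from `u` since it lies in `W - u`, and from `v` since `v ∉ W`; hence it
      -- would separate the twins.
      with w , w∈W-u , ≢d ← proj₂ (wtr W ∣W∣≡r) u v u∈W v∉W
      = twins⇒unseparated twins
          ( w
          , (λ { refl → x∉p-x w∈W-u })
          , (λ { refl → v∉W (p─q⊆p W ⁅ u ⁆ w∈W-u) })
          , ≢-sym ≢d)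

    separated⇒allWTR : n ≥ 2 → (∀ u v → u ≢ v → ∃ (Separates u v)) → AllWTR G conn (n ∸ 1)
    separated⇒allWTR n≥2 separator = ℕ.∸-monoˡ-≤ 1 n≥2 , wtr
      where
      wtr : ∀ W → ∣ W ∣ ≡ n ∸ 1 → IsWTR G conn W
      wtr W ∣W∣≡n-1 = omitted-unique⇒resolving unique , distinguish
        where
        ∣∁W∣≡1 : ∣ ∁ W ∣ ≡ 1
        ∣∁W∣≡1 = trans (∣∁p∣≡n∸∣p∣ W)
          (trans (cong (n ∸_) ∣W∣≡n-1) (ℕ.m∸[m∸n]≡n (ℕ.<⇒≤ n≥2)))
        unique : ∀ {x y} → x ∉ W → y ∉ W → x ≡ y
        unique = ∣∁p∣≤1⇒omitted-unique (ℕ.≤-reflexive ∣∁W∣≡1)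
        distinguish : ∀ w x → w ∈ W → x ∉ W → ∃ λ w′ → w′ ∈ W - w × dist x w′ ≢ dist w w′
        distinguish w x w∈W x∉W =
          let w′ , w′≢x , w′≢w , ≢d = separator x w λ { refl → x∉W w∈W }
              -- `x` is the only vertex outside `W`, and the separator is not `x`.
              w′∈W = decidable-stable (w′ ∈? W) λ w′∉W → w′≢x (unique w′∉W x∉W)
          in w′ , x∈p∧x≢y⇒x∈p-y w′∈W w′≢w , ≢d

    res-wt-allWTR : AllWTR G conn (res-wt G conn)
    res-wt-allWTR = proj₁ (proj₂ (minimum (allWTR? G conn) (allWTR-inhabited G conn)))

    res-wt-least : ∀ {r} → AllWTR G conn r → res-wt G conn ≤ r
    res-wt-least = proj₂ (proj₂ (minimum (allWTR? G conn) (allWTR-inhabited G conn))) _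

theorem5 : (n : ℕ) → n ≥ 3 → (G : Graph n) (conn : Connected G) →
    res-wt G conn ≡ n ⇔ ∃ (IsTwin G)
theorem5 n n≥3 G conn = mk⇔ to from
  where
  to : res-wt G conn ≡ n → ∃ (IsTwin G)
  -- Without twins the size `n ∸ 1` already qualifies, so the minimum could not be `n`.
  to res≡n = fromInj₁ (λ separator → contradiction (n≤n-1 separator) (ℕ.<⇒≱ n-1<n))
    (twin-or-separated G conn)
    where
    n≤n-1 : (∀ u v → u ≢ v → ∃ (Separates G conn u v)) → n ≤ n ∸ 1
    n≤n-1 separator = subst (_≤ n ∸ 1) res≡n
      (res-wt-least G conn (separated⇒allWTR G conn (ℕ.<⇒≤ n≥3) separator))
    n-1<n : n ∸ 1 < n
    n-1<n = ℕ.∸-monoʳ-< (s≤s z≤n) (ℕ.≤-trans (s≤s z≤n) n≥3)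

  from : ∃ (IsTwin G) → res-wt G conn ≡ n
  from (u , v , twins) = ℕ.≤-antisym
    (res-wt-least G conn (allWTR-order G conn (ℕ.≤-trans (s≤s z≤n) n≥3)))
    (ℕ.≮⇒≥ λ res<n → twins⇒¬allWTR G conn twins res<n (res-wt-allWTR G conn))
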